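{- Let $\mathbb K$ be a field of characteristic $p>2$, $r,n\ge1$, and let $\phi_l,\psi_m:\mathbb Z^r\times\mathbb Z^n\to\mathbb K^\times$ ($l=1,\dots,r$, $m=1,\dots,n$) define a $p$-invariant discrete flat connection on the trivial line bundle $\mathbb Z^{r+n}\times\mathbb K\to\mathbb Z^{r+n}$. Then the scalar $p$-curvature functions $$\tilde\phi_l(j,k)=\prod_{i=0}^{p-1}\phi_l(j+ie_l,k),\qquad\tilde\psi_m(j,k)=\prod_{i=0}^{p-1}\psi_m(j,k+if_m)$$ are constant, that is, independent of $(j,k)\in\mathbb Z^r\times\mathbb Z^n$.
   Context: $e_1,\dots,e_r$ and $f_1,\dots,f_n$ are the standard bases of $\mathbb Z^r$ and $\mathbb Z^n$. The functions $(\phi_l,\psi_m)$ define a $p$-invariant discrete flat connection if they are $p$-periodic (invariant under shifts by $pe_i$ and $pf_i$) and satisfy, for all indices and all $(j,k)$: $\phi_l(j+e_i,k)\phi_i(j,k)=\phi_i(j+e_l,k)\phi_l(j,k)$, $\psi_m(j,k+f_i)\psi_i(j,k)=\psi_i(j,k+f_m)\psi_m(j,k)$, and $\psi_m(j+e_i,k)\phi_i(j,k)=\phi_i(j,k+f_m)\psi_m(j,k)$. -}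

module Defs where

open import Algebra.Apartness.Bundles using (HeytingField; HeytingCommutativeRing)
open import Algebra.Bundles using (CommutativeRing; Semiring)
import Algebra.Definitions.RawSemiring as RawSemiringDefinitions
open import Data.Fin.Base using (Fin; toℕ)
open import Data.Integer.Base as ℤ using (ℤ; +_; 0ℤ; 1ℤ)
open import Data.Nat.Base using (ℕ)
open import Data.Nat.Divisibility using (_∣_)
open import Data.Product.Base using (∃; proj₁)
open import Data.Vec.Base using (Vec; map; replicate; zipWith; _[_]≔_)
open import Function.Bundles using (_⇔_)
open import Level using (_⊔_)

ℤ^_ : ℕ → Set
ℤ^ d = Vec ℤ d

infixl 6 _⊕_
infixr 7 _·_

_⊕_ : ∀ {d} → ℤ^ d → ℤ^ d → ℤ^ d
_⊕_ = zipWith ℤ._+_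

_·_ : ∀ {d} → ℕ → ℤ^ d → ℤ^ d
m · v = map (ℤ._*_ (+ m)) v

-- Standard basis vector of ℤ^ d; it plays the role of both e_i (d = r) and
-- f_i (d = n).
e : ∀ {d} → Fin d → ℤ^ d
e {d} i = replicate d 0ℤ [ i ]≔ 1ℤ

-- A Heyting field is the constructive form of a field: classically, with
-- x # y read as "x ≠ y", it is exactly a field.
module _ {c ℓ₁ ℓ₂} (K : HeytingField c ℓ₁ ℓ₂) where

  open HeytingField K using (Carrier; _≈_; _#_; _*_; 0#; 1#; heytingCommutativeRing)
  open CommutativeRing (HeytingCommutativeRing.commutativeRing heytingCommutativeRing)
    using (semiring)
  open RawSemiringDefinitions (Semiring.rawSemiring semiring) using (_×_; product)

  -- p generates the kernel of the canonical map from the integers to K.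
  HasCharacteristic : ℕ → Set ℓ₁
  HasCharacteristic p = ∀ m → (m × 1# ≈ 0#) ⇔ (p ∣ m)

  Units : Set (c ⊔ ℓ₂)
  Units = ∃ λ x → x # 0#

  val : Units → Carrier
  val = proj₁

  record IsInvariantFlatConnection {r n : ℕ} (p : ℕ)
           (φ : Fin r → ℤ^ r → ℤ^ n → Units)
           (ψ : Fin n → ℤ^ r → ℤ^ n → Units) : Set ℓ₁ where
    field
      φ-periodicʳ : ∀ l i j k → val (φ l (j ⊕ p · e i) k) ≈ val (φ l j k)
      φ-periodicⁿ : ∀ l i j k → val (φ l j (k ⊕ p · e i)) ≈ val (φ l j k)
      ψ-periodicʳ : ∀ m i j k → val (ψ m (j ⊕ p · e i) k) ≈ val (ψ m j k)
      ψ-periodicⁿ : ∀ m i j k → val (ψ m j (k ⊕ p · e i)) ≈ val (ψ m j k)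
      φφ-flat : ∀ l i j k →
        val (φ l (j ⊕ e i) k) * val (φ i j k) ≈ val (φ i (j ⊕ e l) k) * val (φ l j k)
      ψψ-flat : ∀ m i j k →
        val (ψ m j (k ⊕ e i)) * val (ψ i j k) ≈ val (ψ i j (k ⊕ e m)) * val (ψ m j k)
      ψφ-flat : ∀ m i j k →
        val (ψ m (j ⊕ e i) k) * val (φ i j k) ≈ val (φ i j (k ⊕ e m)) * val (ψ m j k)

  module _ {r n : ℕ} (p : ℕ) where

    φ-curvature : (Fin r → ℤ^ r → ℤ^ n → Units) → Fin r → ℤ^ r → ℤ^ n → Carrier
    φ-curvature φ l j k = product {p} (λ i → val (φ l (j ⊕ toℕ i · e l) k))

    ψ-curvature : (Fin n → ℤ^ r → ℤ^ n → Units) → Fin n → ℤ^ r → ℤ^ n → Carrier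
    ψ-curvature ψ m j k = product {p} (λ i → val (ψ m j (k ⊕ toℕ i · e m)))

  IsConstant : ∀ {r n} → (ℤ^ r → ℤ^ n → Carrier) → Set ℓ₁
  IsConstant f = ∀ j k j′ k′ → f j k ≈ f j′ k′

{-# OPTIONS --safe #-}
-- Flatness makes the shifted product telescope: if aᵢ are the values of one
-- component along a line of direction l, a′ᵢ their shifts in another
-- direction, and bᵢ the values of the component of that other direction along
-- the line, then a′ᵢ bᵢ = bᵢ₊₁ aᵢ gives (∏ a′ᵢ) b₀ = b_p (∏ aᵢ).  Periodicity
-- gives b_p = b₀, a unit, which cancels.  So the curvatures are invariant under
-- all unit shifts of the lattice, hence constant.
module Submission where

open import Defs
open import Algebra.Apartness.Bundles using (HeytingField; HeytingCommutativeRing)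
import Algebra.Apartness.Properties.HeytingCommutativeRing as HeytingProperties
open import Algebra.Bundles using (CommutativeRing; Semiring)
import Algebra.Definitions.RawSemiring as RawSemiringDefinitions
import Algebra.Properties.CommutativeSemigroup as CommutativeSemigroupProperties
import Algebra.Properties.Monoid.Sum as MonoidSum
open import Data.Fin.Base using (Fin; zero; suc; toℕ)
open import Data.Integer.Base as ℤ using (ℤ; +_; -[1+_]; 0ℤ; 1ℤ)
import Data.Integer.Properties as ℤ
open import Data.Nat.Base using (ℕ; zero; suc; _≤_; _<_)
import Data.Nat.Properties as ℕ
open import Data.Product.Base using (_×_; _,_; proj₁; proj₂)
open import Data.Vec.Base using ([]; _∷_)
open import Data.Vec.Properties using (zipWith-assoc; zipWith-comm; zipWith-identityʳ)
open import Function.Base using (_∘_)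
open import Relation.Binary.Bundles using (Setoid)
open import Relation.Binary.PropositionalEquality as ≡ using (_≡_; cong; cong₂; module ≡-Reasoning)
import Relation.Binary.Reasoning.Setoid as SetoidReasoning

⊕-comm : ∀ {d} (u v : ℤ^ d) → u ⊕ v ≡ v ⊕ u
⊕-comm = zipWith-comm ℤ.+-comm

⊕-assoc : ∀ {d} (u v w : ℤ^ d) → (u ⊕ v) ⊕ w ≡ u ⊕ (v ⊕ w)
⊕-assoc = zipWith-assoc ℤ.+-assoc

⊕-swapʳ : ∀ {d} (u v w : ℤ^ d) → u ⊕ v ⊕ w ≡ u ⊕ w ⊕ v
⊕-swapʳ u v w = begin
  u ⊕ v ⊕ w    ≡⟨ ⊕-assoc u v w ⟩
  u ⊕ (v ⊕ w)  ≡⟨ cong (u ⊕_) (⊕-comm v w) ⟩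
  u ⊕ (w ⊕ v)  ≡⟨ ⊕-assoc u w v ⟨
  u ⊕ w ⊕ v    ∎
  where open ≡-Reasoning

⊕-zero-· : ∀ {d} (u v : ℤ^ d) → u ⊕ 0 · v ≡ u
⊕-zero-· []      []      = ≡.refl
⊕-zero-· (x ∷ u) (_ ∷ v) = cong₂ _∷_ (ℤ.+-identityʳ x) (⊕-zero-· u v)

suc-· : ∀ {d} t (v : ℤ^ d) → suc t · v ≡ v ⊕ t · v
suc-· t []      = ≡.refl
suc-· t (x ∷ v) = cong₂ _∷_ (ℤ.suc-* (+ t) x) (suc-· t v)

⊕-suc-· : ∀ {d} t (u v : ℤ^ d) → u ⊕ suc t · v ≡ u ⊕ t · v ⊕ v
⊕-suc-· t u v = begin
  u ⊕ suc t · v    ≡⟨ cong (u ⊕_) (suc-· t v) ⟩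
  u ⊕ (v ⊕ t · v)  ≡⟨ ⊕-assoc u v (t · v) ⟨
  u ⊕ v ⊕ t · v    ≡⟨ ⊕-swapʳ u v (t · v) ⟩
  u ⊕ t · v ⊕ v    ∎
  where open ≡-Reasoning

module _ {a ℓ} (S : Setoid a ℓ) where

  open Setoid S

  ℤ-shift-invariant⇒constant : (f : ℤ → Carrier) → (∀ x → f (x ℤ.+ 1ℤ) ≈ f x) →
                               ∀ x y → f x ≈ f y
  ℤ-shift-invariant⇒constant f shift x y = trans (≈0 x) (sym (≈0 y))
    where
    ≈0 : ∀ x → f x ≈ f 0ℤ
    ≈0 (+ zero)       = refl
    ≈0 (+ suc n)      = trans
      (reflexive (cong (f ∘ +_) (ℕ.+-comm 1 n)))
      (trans (shift (+ n)) (≈0 (+ n)))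
    ≈0 -[1+ zero ]    = sym (shift -[1+ 0 ])
    ≈0 -[1+ suc n ]   = trans (sym (shift -[1+ suc n ])) (≈0 -[1+ n ])

  shift-invariant⇒constant : ∀ {d} (f : ℤ^ d → Carrier) →
                             (∀ i v → f (v ⊕ e i) ≈ f v) → ∀ v w → f v ≈ f w
  shift-invariant⇒constant f shift []      []      = refl
  shift-invariant⇒constant f shift (x ∷ v) (y ∷ w) = trans
    (ℤ-shift-invariant⇒constant (λ z → f (z ∷ v)) shiftHead x y)
    (shift-invariant⇒constant (λ u → f (y ∷ u)) shiftTail v w)
    where
    shiftHead : ∀ z → f (z ℤ.+ 1ℤ ∷ v) ≈ f (z ∷ v)
    shiftHead z = trans
      (reflexive (cong (λ u → f (z ℤ.+ 1ℤ ∷ u)) (≡.sym (zipWith-identityʳ ℤ.+-identityʳ v))))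
      (shift zero (z ∷ v))

    shiftTail : ∀ i u → f (y ∷ u ⊕ e i) ≈ f (y ∷ u)
    shiftTail i u = trans
      (reflexive (cong (λ z → f (z ∷ u ⊕ e i)) (≡.sym (ℤ.+-identityʳ y))))
      (shift (suc i) (y ∷ u))

module _ {c ℓ₁ ℓ₂} (K : HeytingField c ℓ₁ ℓ₂) where

  open HeytingField K using (Carrier; _≈_; _#_; 0#; 1#; #⇒invertible; heytingCommutativeRing)
  open HeytingProperties heytingCommutativeRing using (x-0≈x)
  open CommutativeRing (HeytingCommutativeRing.commutativeRing heytingCommutativeRing)
    using ( _*_; setoid; sym; trans; reflexive; *-congˡ; *-congʳ; *-assoc; *-comm
          ; *-identityʳ; *-monoid; *-commutativeSemigroup; semiring)
  open RawSemiringDefinitions (Semiring.rawSemiring semiring) using (product)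
  open CommutativeSemigroupProperties *-commutativeSemigroup using (xy∙z≈y∙xz)
  open MonoidSum *-monoid using () renaming (sum-cong-≋ to product-cong)

  *-cancelʳ-#0 : ∀ {x y z} → z # 0# → x * z ≈ y * z → x ≈ y
  *-cancelʳ-#0 {x} {y} {z} z#0 xz≈yz = begin
    x              ≈⟨ *-identityʳ x ⟨
    x * 1#         ≈⟨ *-congˡ zz⁻¹≈1 ⟨
    x * (z * z⁻¹)  ≈⟨ *-assoc x z z⁻¹ ⟨
    x * z * z⁻¹    ≈⟨ *-congʳ xz≈yz ⟩
    y * z * z⁻¹    ≈⟨ *-assoc y z z⁻¹ ⟩
    y * (z * z⁻¹)  ≈⟨ *-congˡ zz⁻¹≈1 ⟩
    y * 1#         ≈⟨ *-identityʳ y ⟩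
    y              ∎
    where
    open SetoidReasoning setoid
    z⁻¹ = proj₁ (#⇒invertible z#0)
    zz⁻¹≈1 : z * z⁻¹ ≈ 1#
    zz⁻¹≈1 = trans (*-congʳ (sym (x-0≈x z))) (proj₂ (proj₂ (#⇒invertible z#0)))

  product-telescope : ∀ p (a a′ b : ℕ → Carrier) →
                      (∀ t → a′ t * b t ≈ b (suc t) * a t) →
                      product {p} (a′ ∘ toℕ) * b 0 ≈ b p * product {p} (a ∘ toℕ)
  product-telescope zero    a a′ b step = *-comm 1# (b 0)
  product-telescope (suc p) a a′ b step = begin
    a′ 0 * Π′ * b 0       ≈⟨ xy∙z≈y∙xz (a′ 0) Π′ (b 0) ⟩
    Π′ * (a′ 0 * b 0)     ≈⟨ *-congˡ (step 0) ⟩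
    Π′ * (b 1 * a 0)      ≈⟨ *-assoc Π′ (b 1) (a 0) ⟨
    Π′ * b 1 * a 0        ≈⟨ *-congʳ (product-telescope p (a ∘ suc) (a′ ∘ suc) (b ∘ suc) (step ∘ suc)) ⟩
    b (suc p) * Π * a 0   ≈⟨ *-assoc (b (suc p)) Π (a 0) ⟩
    b (suc p) * (Π * a 0) ≈⟨ *-congˡ (*-comm Π (a 0)) ⟩
    b (suc p) * (a 0 * Π) ∎
    where
    open SetoidReasoning setoid
    Π′ = product {p} (a′ ∘ suc ∘ toℕ)
    Π  = product {p} (a ∘ suc ∘ toℕ)

  lineProduct-≈ : ∀ p {d} (l : Fin d) (A A′ B : ℤ^ d → Carrier) →
                  (∀ v → B v # 0#) → (∀ v → B (v ⊕ p · e l) ≈ B v) →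
                  (∀ v → A′ v * B v ≈ B (v ⊕ e l) * A v) →
                  ∀ v → product {p} (λ t → A′ (v ⊕ toℕ t · e l))
                      ≈ product {p} (λ t → A (v ⊕ toℕ t · e l))
  lineProduct-≈ p l A A′ B B#0 periodic flat v = *-cancelʳ-#0 (B#0 (v ⊕ 0 · e l)) (begin
    Π′ * B (v ⊕ 0 · e l)  ≈⟨ product-telescope p (λ t → A (v ⊕ t · e l)) (λ t → A′ (v ⊕ t · e l))
                                (λ t → B (v ⊕ t · e l)) step ⟩
    B (v ⊕ p · e l) * Π   ≈⟨ *-congʳ (periodic v) ⟩
    B v * Π               ≈⟨ *-comm (B v) Π ⟩
    Π * B v               ≡⟨ cong (λ u → Π * B u) (⊕-zero-· v (e l)) ⟨
    Π * B (v ⊕ 0 · e l)   ∎)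
    where
    open SetoidReasoning setoid
    Π′ = product {p} (λ t → A′ (v ⊕ toℕ t · e l))
    Π  = product {p} (λ t → A (v ⊕ toℕ t · e l))

    step : ∀ t → A′ (v ⊕ t · e l) * B (v ⊕ t · e l) ≈ B (v ⊕ suc t · e l) * A (v ⊕ t · e l)
    step t = trans (flat (v ⊕ t · e l))
      (*-congʳ (reflexive (cong B (≡.sym (⊕-suc-· t v (e l))))))

  lineProduct-shift : ∀ p {d} (l i : Fin d) (A B : ℤ^ d → Carrier) →
                      (∀ v → B v # 0#) → (∀ v → B (v ⊕ p · e l) ≈ B v) →
                      (∀ v → A (v ⊕ e i) * B v ≈ B (v ⊕ e l) * A v) →
                      ∀ v → product {p} (λ t → A (v ⊕ e i ⊕ toℕ t · e l))
                          ≈ product {p} (λ t → A (v ⊕ toℕ t · e l))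
  lineProduct-shift p l i A B B#0 periodic flat v = trans
    (product-cong {p} (λ t → reflexive (cong A (⊕-swapʳ v (e i) (toℕ t · e l)))))
    (lineProduct-≈ p l A (λ u → A (u ⊕ e i)) B B#0 periodic flat v)

  shift-invariant⇒IsConstant : ∀ {r n} (f : ℤ^ r → ℤ^ n → Carrier) →
                               (∀ i j k → f (j ⊕ e i) k ≈ f j k) →
                               (∀ m j k → f j (k ⊕ e m) ≈ f j k) → IsConstant K f
  shift-invariant⇒IsConstant f shiftʳ shiftⁿ j k j′ k′ = trans
    (shift-invariant⇒constant setoid (λ u → f u k) (λ i u → shiftʳ i u k) j j′)
    (shift-invariant⇒constant setoid (f j′) (λ m u → shiftⁿ m j′ u) k k′)

  module _ {r n p} {φ : Fin r → ℤ^ r → ℤ^ n → Units K} {ψ : Fin n → ℤ^ r → ℤ^ n → Units K}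
           (flatConnection : IsInvariantFlatConnection K p φ ψ) where

    open IsInvariantFlatConnection flatConnection

    φ-curvature-constant : ∀ l → IsConstant K (φ-curvature K p φ l)
    φ-curvature-constant l = shift-invariant⇒IsConstant (φ-curvature K p φ l)
      (λ i j k → lineProduct-shift p l i (λ u → val K (φ l u k)) (λ u → val K (φ i u k))
        (λ u → proj₂ (φ i u k)) (λ u → φ-periodicʳ i l u k) (λ u → φφ-flat l i u k) j)
      (λ m j k → lineProduct-≈ p l (λ u → val K (φ l u k)) (λ u → val K (φ l u (k ⊕ e m)))
        (λ u → val K (ψ m u k))
        (λ u → proj₂ (ψ m u k)) (λ u → ψ-periodicʳ m l u k) (λ u → sym (ψφ-flat m l u k)) j)

    ψ-curvature-constant : ∀ m → IsConstant K (ψ-curvature K p ψ m)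
    ψ-curvature-constant m = shift-invariant⇒IsConstant (ψ-curvature K p ψ m)
      (λ i j k → lineProduct-≈ p m (λ u → val K (ψ m j u)) (λ u → val K (ψ m (j ⊕ e i) u))
        (λ u → val K (φ i j u))
        (λ u → proj₂ (φ i j u)) (λ u → φ-periodicⁿ i m j u) (λ u → ψφ-flat m i j u) k)
      (λ i j k → lineProduct-shift p m i (λ u → val K (ψ m j u)) (λ u → val K (ψ i j u))
        (λ u → proj₂ (ψ i j u)) (λ u → ψ-periodicⁿ i m j u) (λ u → ψψ-flat m i j u) k)

lemma3p1 : ∀ {c ℓ₁ ℓ₂} (K : HeytingField c ℓ₁ ℓ₂) (p : ℕ) →
    HasCharacteristic K p → 2 < p →
    ∀ (r n : ℕ) → 1 ≤ r → 1 ≤ n →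
    (φ : Fin r → ℤ^ r → ℤ^ n → Units K)
    (ψ : Fin n → ℤ^ r → ℤ^ n → Units K) →
    IsInvariantFlatConnection K p φ ψ →
    (∀ (l : Fin r) → IsConstant K (φ-curvature K p φ l)) ×
    (∀ (m : Fin n) → IsConstant K (ψ-curvature K p ψ m))
lemma3p1 K p _ _ r n _ _ φ ψ flatConnection =
  φ-curvature-constant K flatConnection , ψ-curvature-constant K flatConnection
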